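{- If $r \geq 3$ and $t \geq r-1$ are integers, then for all $n$, \[ \mathrm{ex}_r ( n , \textup{Berge- }K_{2,t} ) \leq \left( \frac{ r - 1}{t} \binom{t}{r - 1} + 2t + 1 \right) \mathrm{ex}(n , K_{2,t}). \]
   Context: A hypergraph $H$ is a Berge-$F$ (for a graph $F$) if there is a bijection $f : E(F) \to E(H)$ with $e \subseteq f(e)$ for every $e \in E(F)$. $\mathrm{ex}_r(n,\textup{Berge- }F)$ is the maximum number of edges in an $n$-vertex $r$-uniform hypergraph containing no subhypergraph that is a Berge-$F$. $\mathrm{ex}(n,K_{2,t})$ is the usual Turán number: the maximum number of edges in an $n$-vertex graph with no subgraph isomorphic to $K_{2,t}$. -}

module Defs where

open import Data.Bool.Properties using () renaming (_≟_ to _≟ᵇ_)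
open import Data.Fin.Base using (Fin; zero; suc; cast; combine)
open import Data.Fin.Properties as Fin
  using (all?; any?; combine-injective; injective⇒≤)
open import Data.Fin.Subset
  using (Subset; inside; outside; ⁅_⁆; _∪_; _⊆_; ∣_∣)
  renaming (⊥ to ∅; _∈_ to _∈ˢ_)
open import Data.Fin.Subset.Properties
  using (_⊆?_; anySubset?; x∈⁅x⁆; x∈⁅y⁆⇒x≡y; ∣⁅x⁆∣≡1)
open import Data.Integer.Base using (+_)
open import Data.List.Base as List
  using (List; []; _∷_; length; lookup; allFin; cartesianProductWith)
open import Data.List.Membership.Propositional using (_∈_)
open import Data.List.Membership.Propositional.Properties
  using (∈-lookup; ∈-tabulate⁻)
open import Data.List.Properties using (length-tabulate; lookup-tabulate)
open import Data.List.Relation.Unary.All as All using (All)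
open import Data.List.Relation.Unary.AllPairs using ([]; _∷_)
open import Data.List.Relation.Unary.Any using (index)
open import Data.List.Relation.Unary.Any.Properties using (lookup-index)
import Data.List.Relation.Unary.All.Properties as Allₚ
open import Data.List.Relation.Unary.Unique.Propositional using (Unique)
open import Data.List.Relation.Unary.Unique.Propositional.Properties
  using (cartesianProductWith⁺; tabulate⁺; allFin⁺)
import Data.List.Relation.Unary.Unique.DecPropositional as DecUnique
open import Data.List.Membership.DecPropositional using (_∈?_)
open import Data.Nat.Base using (ℕ; zero; suc; _+_; _^_; _≤_; _<_; z≤n; s≤s)
open import Data.Nat.Properties as ℕ using (_≟_)
open import Data.Product.Base using (∃; _×_; _,_; proj₁; proj₂)
open import Data.Rational.Base using (ℚ; _/_)
open import Data.Sum.Base using (inj₁; inj₂)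
open import Data.Vec.Base as Vec using (Vec; []; _∷_; _++_)
open import Data.Vec.Properties as Vecₚ using (++-injective)
open import Function.Base using (_∘_)
open import Function.Bundles using (_⤖_; mk⤖; module Bijection)
open import Function.Definitions using (Injective; Surjective)
open import Relation.Binary.PropositionalEquality
  using (_≡_; _≗_; refl; sym; trans; cong; cong₂; subst; setoid)
open import Relation.Nullary using (¬_; Dec; yes; no; contradiction)
open import Relation.Nullary.Decidable
  using (map′; ¬?; _×-dec_; _→-dec_)
open import Relation.Unary using (Decidable)

-- A (simple) hypergraph on the vertex set Fin n.  The order of the edge
-- list is irrelevant to all the notions below.

record Hypergraph (n : ℕ) : Set where
  constructor mkHypergraph
  field
    edges    : List (Subset n)
    distinct : Unique edges

  size : ℕ
  size = length edges

  edge : Fin size → Subset n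
  edge = lookup edges

open Hypergraph public

Uniform : ∀ {n} → ℕ → Hypergraph n → Set
Uniform r H = All (λ e → ∣ e ∣ ≡ r) (edges H)

record Graph (n : ℕ) : Set where
  constructor mkGraph
  field
    hypergraph : Hypergraph n
    uniform    : Uniform 2 hypergraph

open Graph public using (hypergraph; uniform)

_⊆ᴴ_ : ∀ {n} → Hypergraph n → Hypergraph n → Set
H′ ⊆ᴴ H = ∀ {e} → e ∈ edges H′ → e ∈ edges H

image : ∀ {k n} → (Fin k → Fin n) → Subset k → Subset n
image φ []            = ∅
image φ (inside  ∷ p) = ⁅ φ zero ⁆ ∪ image (φ ∘ suc) p
image φ (outside ∷ p) = image (φ ∘ suc) p

-- H is a Berge-F.  The injection φ places V(F) inside V(H), and edges are
-- referred to by their positions in the duplicate-free edge lists, so f is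
-- a bijection from E(F) to E(H).

IsBerge : ∀ {k n} → Graph k → Hypergraph n → Set
IsBerge {k} {n} F H =
  ∃ λ (φ : Fin k → Fin n) → Injective _≡_ _≡_ φ ×
  ∃ λ (f : Fin (size (hypergraph F)) ⤖ Fin (size H)) →
    ∀ i → image φ (edge (hypergraph F) i) ⊆ edge H (Bijection.to f i)

ContainsBerge : ∀ {k n} → Graph k → Hypergraph n → Set
ContainsBerge F H = ∃ λ H′ → H′ ⊆ᴴ H × IsBerge F H′

-- A subgraph of G isomorphic to F is the same as an injection of V(F) into
-- V(G) that maps every edge of F to an edge of G.

ContainsGraph : ∀ {k n} → Graph k → Hypergraph n → Set
ContainsGraph {k} {n} F G =
  ∃ λ (φ : Fin k → Fin n) → Injective _≡_ _≡_ φ ×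
    All (λ e → image φ e ∈ edges G) (edges (hypergraph F))

BergeFree : ∀ {k n} → ℕ → Graph k → Hypergraph n → Set
BergeFree r F H = Uniform r H × ¬ ContainsBerge F H

GraphFree : ∀ {k n} → Graph k → Hypergraph n → Set
GraphFree F G = Uniform 2 G × ¬ ContainsGraph F G

-- The complete bipartite graph: the first s vertices form one part, the
-- last t vertices the other.

joining : ∀ {s t} → Fin s → Fin t → Subset (s + t)
joining i j = ⁅ i ⁆ ++ ⁅ j ⁆

⁅⁆-injective : ∀ {n} {i j : Fin n} → ⁅ i ⁆ ≡ ⁅ j ⁆ → i ≡ j
⁅⁆-injective {i = i} {j} eq = x∈⁅y⁆⇒x≡y j (subst (i ∈ˢ_) eq (x∈⁅x⁆ i))

joining-injective : ∀ {s t} {i i′ : Fin s} {j j′ : Fin t} →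
                    joining i j ≡ joining i′ j′ → i ≡ i′ × j ≡ j′
joining-injective {i = i} {i′} eq with ++-injective ⁅ i ⁆ ⁅ i′ ⁆ eq
... | p , q = ⁅⁆-injective p , ⁅⁆-injective q

∣++∣ : ∀ {m n} (p : Subset m) (q : Subset n) → ∣ p ++ q ∣ ≡ ∣ p ∣ + ∣ q ∣
∣++∣ []            q = refl
∣++∣ (inside  ∷ p) q = cong suc (∣++∣ p q)
∣++∣ (outside ∷ p) q = ∣++∣ p q

∣joining∣ : ∀ {s t} (i : Fin s) (j : Fin t) → ∣ joining i j ∣ ≡ 2
∣joining∣ i j = trans (∣++∣ ⁅ i ⁆ ⁅ j ⁆) (cong₂ _+_ (∣⁅x⁆∣≡1 i) (∣⁅x⁆∣≡1 j))

K : (s t : ℕ) → Graph (s + t)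
K s t = mkGraph
  (mkHypergraph
    (cartesianProductWith joining (allFin s) (allFin t))
    (cartesianProductWith⁺ joining joining-injective (allFin⁺ s) (allFin⁺ t)))
  (Allₚ.cartesianProductWith⁺ (setoid _) (setoid _)
    joining (allFin s) (allFin t) (λ {i} {j} _ _ → ∣joining∣ i j))

-- Exhaustive search: the properties above are decidable, so that the extremal
-- numbers can be defined as functions rather than as relations.

Searchable : Set → Set₁
Searchable A = ∀ {P : A → Set} → Decidable P → Dec (∃ P)

search-vec : ∀ {A} → Searchable A → ∀ m → Searchable (Vec A m)
search-vec s zero    P? = map′ ([] ,_) (λ { ([] , p) → p }) (P? [])
search-vec s (suc m) P? =
  map′ (λ { (x , xs , p) → x ∷ xs , p }) (λ { (x ∷ xs , p) → x , xs , p })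
       (s λ x → search-vec s m λ xs → P? (x ∷ xs))

search-list : ∀ {A} → Searchable A → ∀ m {P : List A → Set} → Decidable P →
              Dec (∃ λ xs → length xs ≡ m × P xs)
search-list s zero P? =
  map′ (λ p → [] , refl , p) (λ { ([] , refl , p) → p }) (P? [])
search-list s (suc m) P? =
  map′ (λ { (x , xs , refl , p) → x ∷ xs , refl , p })
       (λ { (x ∷ xs , refl , p) → x , xs , refl , p })
       (s λ x → search-list s m λ xs → P? (x ∷ xs))

search-map : ∀ {k n} {P : (Fin k → Fin n) → Set} →
             (∀ {f g} → f ≗ g → P f → P g) → Decidable P → Dec (∃ P)
search-map {k} resp P? =
  map′ (λ { (v , p) → Vec.lookup v , p })
       (λ { (f , p) → Vec.tabulate f , resp (sym ∘ Vecₚ.lookup∘tabulate f) p })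
       (search-vec any? k (P? ∘ Vec.lookup))

injective-resp : ∀ {k n} {f g : Fin k → Fin n} → f ≗ g →
                 Injective _≡_ _≡_ f → Injective _≡_ _≡_ g
injective-resp f≗g inj {i} {j} eq =
  inj (trans (f≗g i) (trans eq (sym (f≗g j))))

injective? : ∀ {k n} (f : Fin k → Fin n) → Dec (Injective _≡_ _≡_ f)
injective? f =
  map′ (λ h {i} {j} → h i j) (λ h i j → h)
       (all? λ i → all? λ j → (f i Fin.≟ f j) →-dec (i Fin.≟ j))

image-cong : ∀ {k n} {φ ψ : Fin k → Fin n} → φ ≗ ψ →
             ∀ e → image φ e ≡ image ψ e
image-cong φ≗ψ []            = refl
image-cong φ≗ψ (inside  ∷ e) =
  cong₂ (λ x p → ⁅ x ⁆ ∪ p) (φ≗ψ zero) (image-cong (φ≗ψ ∘ suc) e)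
image-cong φ≗ψ (outside ∷ e) = image-cong (φ≗ψ ∘ suc) e

_≟ˢ_ : ∀ {n} (p q : Subset n) → Dec (p ≡ q)
_≟ˢ_ = Vecₚ.≡-dec _≟ᵇ_

uniform? : ∀ {n} r → Decidable (Uniform {n} r)
uniform? r H = All.all? (λ e → ∣ e ∣ ≟ r) (edges H)

containsGraph? : ∀ {k n} (F : Graph k) → Decidable (ContainsGraph {k} {n} F)
containsGraph? F G = search-map
  (λ φ≗ψ (inj , all) → injective-resp φ≗ψ inj ,
    All.map (λ {e} → subst (_∈ edges G) (image-cong φ≗ψ e)) all)
  (λ φ → injective? φ ×-dec
    All.all? (λ e → _∈?_ _≟ˢ_ (image φ e) (edges G)) (edges (hypergraph F)))

lookup-injective : ∀ {A : Set} {xs : List A} → Unique xs →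
                   Injective _≡_ _≡_ (lookup xs)
lookup-injective (px ∷ u) {zero}  {zero}  eq = refl
lookup-injective (px ∷ u) {zero}  {suc j} eq =
  contradiction eq (All.lookup px (∈-lookup j))
lookup-injective (px ∷ u) {suc i} {zero}  eq =
  contradiction (sym eq) (All.lookup px (∈-lookup i))
lookup-injective (px ∷ u) {suc i} {suc j} eq = cong suc (lookup-injective u eq)

edge-injective : ∀ {n} (H : Hypergraph n) → Injective _≡_ _≡_ (edge H)
edge-injective H = lookup-injective (distinct H)

-- Containing a Berge-F amounts to an injection (rather than a bijection)
-- from E(F) to E(H); the sub-hypergraph is then the range of the injection.

InjectsBerge : ∀ {k n} → Graph k → Hypergraph n → Set
InjectsBerge {k} {n} F H =
  ∃ λ (φ : Fin k → Fin n) → Injective _≡_ _≡_ φ ×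
  ∃ λ (g : Fin (size (hypergraph F)) → Fin (size H)) → Injective _≡_ _≡_ g ×
    (∀ i → image φ (edge (hypergraph F) i) ⊆ edge H (g i))

injects⇒contains : ∀ {k n} (F : Graph k) (H : Hypergraph n) →
                   InjectsBerge F H → ContainsBerge F H
injects⇒contains F H (φ , φ-inj , g , g-inj , φe⊆) =
  H′ , H′⊆H , φ , φ-inj , mk⤖ (f-inj , f-surj) , λ i →
    subst (image φ (edge (hypergraph F) i) ⊆_) (sym (lookup-tabulate h i)) (φe⊆ i)
  where
  h = edge H ∘ g

  H′ = mkHypergraph (List.tabulate h) (tabulate⁺ (g-inj ∘ edge-injective H))

  H′⊆H : H′ ⊆ᴴ H
  H′⊆H e∈ with ∈-tabulate⁻ e∈
  ... | i , refl = ∈-lookup (g i)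

  len = length-tabulate h

  f = cast (sym len)

  f-inj : Injective _≡_ _≡_ f
  f-inj {i} {j} eq = trans (sym (Fin.cast-involutive len (sym len) i))
    (trans (cong (cast len) eq) (Fin.cast-involutive len (sym len) j))

  f-surj : Surjective _≡_ _≡_ f
  f-surj j = cast len j , λ { refl → Fin.cast-involutive (sym len) len j }

contains⇒injects : ∀ {k n} (F : Graph k) (H : Hypergraph n) →
                   ContainsBerge F H → InjectsBerge F H
contains⇒injects F H (H′ , H′⊆H , φ , φ-inj , f , φe⊆) =
  φ , φ-inj , g , g-inj , λ i →
    subst (image φ (edge (hypergraph F) i) ⊆_) (edge-g i) (φe⊆ i)
  where
  open Bijection f using (to; injective)

  g : Fin (size (hypergraph F)) → Fin (size H)
  g i = index (H′⊆H (∈-lookup (to i)))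

  edge-g : ∀ i → edge H′ (to i) ≡ edge H (g i)
  edge-g i = lookup-index (H′⊆H (∈-lookup (to i)))

  g-inj : Injective _≡_ _≡_ g
  g-inj {i} {j} eq = injective (edge-injective H′
    (trans (edge-g i) (trans (cong (edge H) eq) (sym (edge-g j)))))

containsBerge? : ∀ {k n} (F : Graph k) → Decidable (ContainsBerge {k} {n} F)
containsBerge? F H = map′ (injects⇒contains F H) (contains⇒injects F H)
  (search-map
    (λ φ≗ψ (inj , g , g-inj , φe⊆) → injective-resp φ≗ψ inj , g , g-inj ,
      λ i → subst (_⊆ edge H (g i))
        (image-cong φ≗ψ (edge (hypergraph F) i)) (φe⊆ i))
    (λ φ → injective? φ ×-dec search-map
      (λ g≗h (g-inj , φe⊆) → injective-resp g≗h g-inj ,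
        λ i → subst (λ j → image φ (edge (hypergraph F) i) ⊆ edge H j)
          (g≗h i) (φe⊆ i))
      (λ g → injective? g ×-dec all? λ i → _ ⊆? _)))

bergeFree? : ∀ {k n} r (F : Graph k) → Decidable (BergeFree {k} {n} r F)
bergeFree? r F H = uniform? r H ×-dec ¬? (containsBerge? F H)

graphFree? : ∀ {k n} (F : Graph k) → Decidable (GraphFree {k} {n} F)
graphFree? F G = uniform? 2 G ×-dec ¬? (containsGraph? F G)

-- The injection code only serves to bound the number of edges by 2 ^ n.

code : ∀ {n} → Subset n → Fin (2 ^ n)
code []            = zero
code (inside  ∷ p) = combine {2} (suc zero) (code p)
code (outside ∷ p) = combine {2} zero (code p)

code-injective : ∀ {n} {p q : Subset n} → code p ≡ code q → p ≡ q
code-injective {p = []} {[]} eq = refl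
code-injective {p = inside ∷ p} {inside ∷ q} eq =
  cong (inside ∷_) (code-injective
    (proj₂ (combine-injective {2} (suc zero) (code p) (suc zero) (code q) eq)))
code-injective {p = outside ∷ p} {outside ∷ q} eq =
  cong (outside ∷_) (code-injective
    (proj₂ (combine-injective {2} zero (code p) zero (code q) eq)))
code-injective {p = inside ∷ p} {outside ∷ q} eq
  with () ← proj₁ (combine-injective {2} (suc zero) (code p) zero (code q) eq)
code-injective {p = outside ∷ p} {inside ∷ q} eq
  with () ← proj₁ (combine-injective {2} zero (code p) (suc zero) (code q) eq)

size≤2^n : ∀ {n} (H : Hypergraph n) → size H ≤ 2 ^ n
size≤2^n H = injective⇒≤ {f = code ∘ edge H} (edge-injective H ∘ code-injective)

-- The largest m ≤ b satisfying Q; the value 0 is also returned if there is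
-- no such m.

largest : ∀ {Q : ℕ → Set} → Decidable Q → ℕ → ℕ
largest Q? zero    = 0
largest Q? (suc b) with Q? (suc b)
... | yes _ = suc b
... | no  _ = largest Q? b

largest-upper : ∀ {Q : ℕ → Set} (Q? : Decidable Q) {b m} →
                m ≤ b → Q m → m ≤ largest Q? b
largest-upper Q? {zero}  z≤n q = z≤n
largest-upper Q? {suc b} m≤b q with Q? (suc b)
... | yes _ = m≤b
... | no ¬q with ℕ.m≤n⇒m<n∨m≡n m≤b
...   | inj₁ (s≤s m≤b′) = largest-upper Q? m≤b′ q
...   | inj₂ refl       = contradiction q ¬q

largest-attained : ∀ {Q : ℕ → Set} (Q? : Decidable Q) {b m} →
                   m ≤ b → Q m → Q (largest Q? b)
largest-attained Q? {zero}  z≤n q = q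
largest-attained Q? {suc b} m≤b q with Q? (suc b)
... | yes q′ = q′
... | no ¬q with ℕ.m≤n⇒m<n∨m≡n m≤b
...   | inj₁ (s≤s m≤b′) = largest-attained Q? m≤b′ q
...   | inj₂ refl       = contradiction q ¬q

-- The maximum number of edges of a hypergraph on n vertices satisfying P
-- (0 if none does); P must not inspect the proof that edges are distinct.

IrrelevantIn : ∀ {n} → (Hypergraph n → Set) → Set
IrrelevantIn P = ∀ es u u′ → P (mkHypergraph es u) → P (mkHypergraph es u′)

Attains : ∀ {n} → (Hypergraph n → Set) → ℕ → Set
Attains P m = ∃ λ H → size H ≡ m × P H

attains? : ∀ {n} {P : Hypergraph n → Set} → IrrelevantIn P → Decidable P →
           Decidable (Attains P)
attains? {n} {P} irr P? m =
  map′ (λ { (es , eq , u , p) → mkHypergraph es u , eq , p })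
       (λ { (mkHypergraph es u , eq , p) → es , eq , u , p })
       (search-list anySubset? m valid?)
  where
  valid? : ∀ es → Dec (∃ λ u → P (mkHypergraph es u))
  valid? es with DecUnique.unique? _≟ˢ_ es
  ... | no ¬u = no (¬u ∘ proj₁)
  ... | yes u = map′ (u ,_) (λ { (u′ , p) → irr es u′ u p })
                     (P? (mkHypergraph es u))

maxSize : ∀ {n} {P : Hypergraph n → Set} → IrrelevantIn P → Decidable P → ℕ
maxSize {n} irr P? = largest (attains? irr P?) (2 ^ n)

maxSize-upper : ∀ {n} {P : Hypergraph n → Set}
                (irr : IrrelevantIn P) (P? : Decidable P) →
                ∀ H → P H → size H ≤ maxSize irr P?
maxSize-upper irr P? H p =
  largest-upper (attains? irr P?) (size≤2^n H) (H , refl , p)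

maxSize-attained : ∀ {n} {P : Hypergraph n → Set}
                   (irr : IrrelevantIn P) (P? : Decidable P) →
                   ∃ P → Attains P (maxSize irr P?)
maxSize-attained irr P? (H , p) =
  largest-attained (attains? irr P?) (size≤2^n H) (H , refl , p)

-- exBerge r n F is ex_r(n, Berge-F), and ex n F is ex(n, F).

exBerge : ∀ {k} → ℕ → ℕ → Graph k → ℕ
exBerge r n F = maxSize {n} {BergeFree r F} (λ _ _ _ p → p) (bergeFree? r F)

ex : ∀ {k} → ℕ → Graph k → ℕ
ex n F = maxSize {n} {GraphFree F} (λ _ _ _ p → p) (graphFree? F)

-- If F has an edge then the empty hypergraph is admissible, so the fallback
-- value 0 of maxSize plays no role: both numbers are genuine maxima.

exBerge-upper : ∀ {k r n} (F : Graph k) (H : Hypergraph n) →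
                BergeFree r F H → size H ≤ exBerge r n F
exBerge-upper {r = r} F H =
  maxSize-upper {P = BergeFree r F} (λ _ _ _ p → p) (bergeFree? r F) H

exBerge-attained : ∀ {k} r n (F : Graph k) → 0 < size (hypergraph F) →
                   ∃ λ (H : Hypergraph n) → size H ≡ exBerge r n F × BergeFree r F H
exBerge-attained r n F 0<F =
  maxSize-attained {P = BergeFree r F} (λ _ _ _ p → p) (bergeFree? r F)
    (mkHypergraph [] [] , All.[] , λ c →
      let _ , _ , _ , g-inj , _ = contains⇒injects F (mkHypergraph [] []) c
      in ℕ.n≮0 (ℕ.<-≤-trans 0<F (injective⇒≤ g-inj)))

ex-upper : ∀ {k n} (F : Graph k) (G : Hypergraph n) →
           GraphFree F G → size G ≤ ex n F
ex-upper F G = maxSize-upper {P = GraphFree F} (λ _ _ _ p → p) (graphFree? F) G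

ex-attained : ∀ {k} n (F : Graph k) → 0 < size (hypergraph F) →
              ∃ λ (G : Hypergraph n) → size G ≡ ex n F × GraphFree F G
ex-attained n F 0<F =
  maxSize-attained {P = GraphFree F} (λ _ _ _ p → p) (graphFree? F)
    (mkHypergraph [] [] , All.[] , λ (_ , _ , all) → edgeless 0<F all)
  where
  edgeless : ∀ {A : Set} {P : A → Subset n} {es : List A} →
             0 < length es → ¬ All (λ e → P e ∈ []) es
  edgeless 0<es (() All.∷ _)

fromℕ : ℕ → ℚ
fromℕ m = + m / 1

{-# OPTIONS --safe #-}
module Submission where

open import Defs
open import Data.Integer.Base using (+_)
open import Data.Nat.Base using (ℕ; NonZero; _∸_; _≤_)
open import Data.Nat.Combinatorics using (_C_)
open import Data.Rational.Base using (_/_) renaming (_+_ to _+ℚ_; _*_ to _*ℚ_; _≤_ to _≤ℚ_)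

open import Data.Fin.Base using (Fin; zero; suc; splitAt; _↑ˡ_; _↑ʳ_)
open import Data.Fin.Properties as Fin using (all?; any?; splitAt-↑ˡ; splitAt-↑ʳ)
open import Data.Fin.Subset
  using (Subset; inside; outside; ⁅_⁆; _∪_; _─_; _⊆_; ∣_∣)
  renaming (⊥ to ∅; _∈_ to _∈ˢ_; _∉_ to _∉ˢ_)
open import Data.Fin.Subset.Properties
  using (_∈?_; x∈⁅x⁆; x∈⁅y⁆⇒x≡y; ∣⁅x⁆∣≡1; ∪-identityˡ; ∪-identityʳ; ∪-assoc;
         ⊆-antisym; drop-∷-⊆; x∈p∪q⁺; x∈p∪q⁻; x∈p∧x∉q⇒x∈p─q; p─q⊆p; ∉⊥)
import Data.Integer.Base as ℤ
import Data.Integer.Properties as ℤ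
open import Data.List.Base
  using (List; []; _∷_; [_]; _++_; length; lookup; map; concatMap; allFin)
import Data.List.Membership.DecPropositional as DecMembership
open import Data.List.Membership.Propositional using (_∈_; _∉_)
open import Data.List.Membership.Propositional.Properties
  using (∈-lookup; ∈-map⁺; ∈-map⁻; ∈-++⁺ˡ; ∈-++⁺ʳ; ∈-concatMap⁺; ∈-cartesianProductWith⁻)
open import Data.List.Properties using (length-map; length-++)
open import Data.List.Relation.Binary.Sublist.Propositional as Sublist
  using ([]; _∷_; _∷ʳ_) renaming (_⊆_ to _⊑_)
open import Data.List.Relation.Binary.Sublist.Propositional.Properties using (All-resp-⊆)
open import Data.List.Relation.Unary.All as All using (All; []; _∷_)
import Data.List.Relation.Unary.All.Properties as Allₚ
open import Data.List.Relation.Unary.AllPairs using ([]; _∷_)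
open import Data.List.Relation.Unary.Any as Any using (here; there; index)
open import Data.List.Relation.Unary.Any.Properties using (lookup-index)
open import Data.List.Relation.Unary.Unique.Propositional using (Unique)
open import Data.Nat.Base
  using (zero; suc; _<_; _+_; _*_; z≤n; s≤s; s≤s⁻¹; _≤′_; ≤′-refl; ≤′-step)
open import Data.Nat.Combinatorics using (nCk+nC[k+1]≡[n+1]C[k+1]; k>n⇒nCk≡0; nC1≡n)
import Data.Nat.Properties as ℕ
open import Data.Product.Base using (∃; _×_; _,_; proj₁; proj₂)
open import Data.Rational.Base using (toℚᵘ)
import Data.Rational.Properties as ℚ
open import Data.Rational.Unnormalised.Base as ℚᵘ using (ℚᵘ; mkℚᵘ; *≡*; *≤*)
import Data.Rational.Unnormalised.Properties as ℚᵘ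
open import Data.Sum.Base using (inj₁; inj₂; [_,_]′)
open import Data.Vec.Base using ([]; _∷_; tabulate; here; there) renaming (_++_ to _++ᵛ_)
open import Data.Vec.Properties using (lookup∘tabulate; []=⇒lookup; lookup⇒[]=)
open import Function.Base using (_∘_)
open import Function.Definitions using (Injective)
open import Relation.Binary.PropositionalEquality
  using (_≡_; _≢_; refl; sym; trans; cong; cong₂; subst; subst₂; module ≡-Reasoning)
open import Relation.Nullary using (¬_; yes; no; does; contradiction)
open import Relation.Nullary.Decidable using (¬?; _×-dec_; _→-dec_; dec-true; decidable-stable)
open import Relation.Unary using (Decidable)

-- Going through the hyperedges of H one by one, choose in each of them a pair
-- of vertices that has not been chosen before, if there is one.  The chosen
-- pairs form a graph G, and a K_{2,t} in G would give a Berge-K_{2,t} in H, so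
-- G has at most ex(n, K_{2,t}) edges.  A hyperedge in which no pair could be
-- chosen is an r-clique of G.  It contains an edge p of G, and its other r - 2
-- vertices are common neighbours of the ends of p, of which there are at most
-- t - 1.  Hence there are at most C(t - 1, r - 2) ex(n, K_{2,t}) such
-- hyperedges, and C(t - 1, r - 2) = (r - 1) / t * C(t, r - 1).

private variable
  A B : Set
  k m n r s t : ℕ

-- Lists

-- Pigeonhole: sending each position of `xs` to a position of the same element in `ys` is injective,
-- because `xs` has no repetitions.
unique-⊆⇒length≤ : {xs ys : List A} → Unique xs → (∀ {x} → x ∈ xs → x ∈ ys) →
                   length xs ≤ length ys
unique-⊆⇒length≤ {xs = xs} {ys} u xs⊆ys = Fin.injective⇒≤ {f = f} λ {i} {j} eq →
  lookup-injective u (trans (lookup-f i) (trans (cong (lookup ys) eq) (sym (lookup-f j))))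
  where
  f : Fin (length xs) → Fin (length ys)
  f i = index (xs⊆ys (∈-lookup i))

  lookup-f : ∀ i → lookup xs i ≡ lookup ys (f i)
  lookup-f i = lookup-index (xs⊆ys (∈-lookup i))

length-concatMap≤ : (f : A → List B) {b : ℕ} (xs : List A) →
                    (∀ {x} → x ∈ xs → length (f x) ≤ b) →
                    length (concatMap f xs) ≤ length xs * b
length-concatMap≤ f []       h = z≤n
length-concatMap≤ f (x ∷ xs) h =
  ℕ.≤-trans (ℕ.≤-reflexive (length-++ (f x)))
    (ℕ.+-mono-≤ (h (here refl)) (length-concatMap≤ f xs (h ∘ there)))

-- Needed to recover a chosen pair from the hyperedge it was chosen in.
unique-map⇒injective : (f : A → B) {xs : List A} → Unique (map f xs) →
                       ∀ {x y} → x ∈ xs → y ∈ xs → f x ≡ f y → x ≡ y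
unique-map⇒injective f (_  ∷ u) (here refl) (here refl) eq = refl
unique-map⇒injective f (≢s ∷ u) (here refl) (there y∈)  eq =
  contradiction eq (All.lookup ≢s (∈-map⁺ f y∈))
unique-map⇒injective f (≢s ∷ u) (there x∈)  (here refl) eq =
  contradiction (sym eq) (All.lookup ≢s (∈-map⁺ f x∈))
unique-map⇒injective f (_  ∷ u) (there x∈)  (there y∈)  eq =
  unique-map⇒injective f u x∈ y∈ eq

⊑-unique : {xs ys : List A} → xs ⊑ ys → Unique ys → Unique xs
⊑-unique []         []       = []
⊑-unique (y ∷ʳ τ)   (_ ∷ u)  = ⊑-unique τ u
⊑-unique (refl ∷ τ) (≢s ∷ u) = All-resp-⊆ τ ≢s ∷ ⊑-unique τ u

-- Binomial coefficients

nCk≤[1+n]Ck : ∀ n k → n C k ≤ suc n C k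
nCk≤[1+n]Ck n zero    = ℕ.≤-refl
nCk≤[1+n]Ck n (suc k) =
  ℕ.≤-trans (ℕ.m≤n+m _ (n C k)) (ℕ.≤-reflexive (nCk+nC[k+1]≡[n+1]C[k+1] n k))

C-monoˡ-≤ : ∀ k → m ≤ n → m C k ≤ n C k
C-monoˡ-≤ k = go ∘ ℕ.≤⇒≤′
  where
  go : m ≤′ n → m C k ≤ n C k
  go ≤′-refl     = ℕ.≤-refl
  go (≤′-step p) = ℕ.≤-trans (go p) (nCk≤[1+n]Ck _ k)

-- The absorption identity, which identifies `(r - 1) / t * C(t, r - 1)` with `C(t - 1, r - 2)`.
-- Induction on `n`, using Pascal's rule once to split and once to recombine.
[1+k]*[1+n]C[1+k]≡[1+n]*nCk : ∀ n k → suc k * (suc n C suc k) ≡ suc n * (n C k)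
[1+k]*[1+n]C[1+k]≡[1+n]*nCk n zero =
  trans (ℕ.*-identityˡ _) (trans (nC1≡n (suc n)) (sym (ℕ.*-identityʳ _)))
[1+k]*[1+n]C[1+k]≡[1+n]*nCk zero (suc k)
  rewrite k>n⇒nCk≡0 {1} {suc (suc k)} (s≤s (s≤s z≤n))
        | k>n⇒nCk≡0 {0} {suc k} (s≤s z≤n) = ℕ.*-zeroʳ (suc (suc k))
[1+k]*[1+n]C[1+k]≡[1+n]*nCk (suc n) (suc k) = begin
  suc (suc k) * (suc (suc n) C suc (suc k))
    ≡⟨ cong (suc (suc k) *_) (nCk+nC[k+1]≡[n+1]C[k+1] (suc n) (suc k)) ⟨
  suc (suc k) * (c + suc n C suc (suc k))
    ≡⟨ ℕ.*-distribˡ-+ (suc (suc k)) c _ ⟩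
  suc (suc k) * c + suc (suc k) * (suc n C suc (suc k))
    -- One copy of `c` splits off `suc (suc k) * c` by computation, so that the rest is the
    -- induction hypothesis at `k`; the other summand is the one at `suc k`.
    ≡⟨ cong₂ (λ x y → c + x + y) ([1+k]*[1+n]C[1+k]≡[1+n]*nCk n k)
                                 ([1+k]*[1+n]C[1+k]≡[1+n]*nCk n (suc k)) ⟩
  c + suc n * (n C k) + suc n * (n C suc k)
    ≡⟨ ℕ.+-assoc c _ _ ⟩
  c + (suc n * (n C k) + suc n * (n C suc k))
    ≡⟨ cong (λ x → c + x) (ℕ.*-distribˡ-+ (suc n) (n C k) _) ⟨
  c + suc n * (n C k + n C suc k)
    ≡⟨ cong (λ x → c + suc n * x) (nCk+nC[k+1]≡[n+1]C[k+1] n k) ⟩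
  suc (suc n) * c ∎
  where
  open ≡-Reasoning
  c = suc n C suc k

-- Finite subsets

∣⁅x⁆∪⁅y⁆∣≡2 : {x y : Fin n} → x ≢ y → ∣ ⁅ x ⁆ ∪ ⁅ y ⁆ ∣ ≡ 2
∣⁅x⁆∪⁅y⁆∣≡2 {x = zero}  {zero}  x≢y = contradiction refl x≢y
∣⁅x⁆∪⁅y⁆∣≡2 {x = zero}  {suc y} x≢y =
  cong suc (trans (cong ∣_∣ (∪-identityˡ ⁅ y ⁆)) (∣⁅x⁆∣≡1 y))
∣⁅x⁆∪⁅y⁆∣≡2 {x = suc x} {zero}  x≢y =
  cong suc (trans (cong ∣_∣ (∪-identityʳ ⁅ x ⁆)) (∣⁅x⁆∣≡1 x))
∣⁅x⁆∪⁅y⁆∣≡2 {x = suc x} {suc y} x≢y = ∣⁅x⁆∪⁅y⁆∣≡2 (x≢y ∘ cong suc)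

⁅x⁆∪⁅y⁆⊆ : {x y : Fin n} {p : Subset n} → x ∈ˢ p → y ∈ˢ p → ⁅ x ⁆ ∪ ⁅ y ⁆ ⊆ p
⁅x⁆∪⁅y⁆⊆ {x = x} {y} {p} x∈p y∈p z∈ with x∈p∪q⁻ ⁅ x ⁆ ⁅ y ⁆ z∈
... | inj₁ z∈x = subst (_∈ˢ p) (sym (x∈⁅y⁆⇒x≡y x z∈x)) x∈p
... | inj₂ z∈y = subst (_∈ˢ p) (sym (x∈⁅y⁆⇒x≡y y z∈y)) y∈p

enumerate : (p : Subset n) → t ≤ ∣ p ∣ →
            ∃ λ (f : Fin t → Fin n) → Injective _≡_ _≡_ f × ∀ i → f i ∈ˢ p
enumerate {t = zero}  p             _ = (λ ()) , (λ { {()} }) , λ ()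
enumerate {t = suc t} (outside ∷ p) h with enumerate p h
... | f , inj , f∈ = suc ∘ f , inj ∘ Fin.suc-injective , there ∘ f∈
enumerate {t = suc t} (inside ∷ p) (s≤s h) with enumerate p h
... | f , inj , f∈ = g , g-inj , g∈
  where
  g : Fin (suc t) → Fin _
  g zero    = zero
  g (suc i) = suc (f i)

  g-inj : Injective _≡_ _≡_ g
  g-inj {zero}  {zero}  eq = refl
  g-inj {suc i} {suc j} eq = cong suc (inj (Fin.suc-injective eq))

  g∈ : ∀ i → g i ∈ˢ inside ∷ p
  g∈ zero    = here
  g∈ (suc i) = there (f∈ i)

⟦_⟧ : {P : Fin n → Set} → Decidable P → Subset n
⟦ P? ⟧ = tabulate (does ∘ P?)

∈⟦⟧⁺ : {P : Fin n → Set} (P? : Decidable P) {x : Fin n} → P x → x ∈ˢ ⟦ P? ⟧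
∈⟦⟧⁺ P? {x} px = lookup⇒[]= x ⟦ P? ⟧ (trans (lookup∘tabulate _ x) (dec-true (P? x) px))

∈⟦⟧⁻ : {P : Fin n → Set} (P? : Decidable P) {x : Fin n} → x ∈ˢ ⟦ P? ⟧ → P x
∈⟦⟧⁻ P? {x} x∈ with P? x | trans (sym (lookup∘tabulate (does ∘ P?) x)) ([]=⇒lookup x∈)
... | yes px | _  = px
... | no _   | ()

x∈p─q⇒x∉q : (p q : Subset n) {x : Fin n} → x ∈ˢ p ─ q → x ∉ˢ q
x∈p─q⇒x∉q (_ ∷ p) (inside  ∷ q) (there x∈) (there x∈q) = x∈p─q⇒x∉q p q x∈ x∈q
x∈p─q⇒x∉q (_ ∷ p) (outside ∷ q) (there x∈) (there x∈q) = x∈p─q⇒x∉q p q x∈ x∈q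

p∪q─p≡q : {p q : Subset n} → p ⊆ q → p ∪ (q ─ p) ≡ q
p∪q─p≡q {p = p} {q} p⊆q = ⊆-antisym
  (λ x∈ → [ p⊆q , p─q⊆p q p ]′ (x∈p∪q⁻ p (q ─ p) x∈))
  q⊆
  where
  q⊆ : q ⊆ p ∪ (q ─ p)
  q⊆ {x} x∈q with x ∈? p
  ... | yes x∈p = x∈p∪q⁺ (inj₁ x∈p)
  ... | no  x∉p = x∈p∪q⁺ (inj₂ (x∈p∧x∉q⇒x∈p─q x∈q x∉p))

∣p∣+∣q─p∣≡∣q∣ : (p q : Subset n) → p ⊆ q → ∣ p ∣ + ∣ q ─ p ∣ ≡ ∣ q ∣
∣p∣+∣q─p∣≡∣q∣ []            []            p⊆q = refl
∣p∣+∣q─p∣≡∣q∣ (outside ∷ p) (outside ∷ q) p⊆q = ∣p∣+∣q─p∣≡∣q∣ p q (drop-∷-⊆ p⊆q)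
∣p∣+∣q─p∣≡∣q∣ (outside ∷ p) (inside  ∷ q) p⊆q =
  trans (ℕ.+-suc ∣ p ∣ _) (cong suc (∣p∣+∣q─p∣≡∣q∣ p q (drop-∷-⊆ p⊆q)))
∣p∣+∣q─p∣≡∣q∣ (inside  ∷ p) (inside  ∷ q) p⊆q =
  cong suc (∣p∣+∣q─p∣≡∣q∣ p q (drop-∷-⊆ p⊆q))
∣p∣+∣q─p∣≡∣q∣ (inside  ∷ p) (outside ∷ q) p⊆q with () ← p⊆q here

-- Listing the subsets of a given size

subsetsOfSize   : Subset n → ℕ → List (Subset n)
-- Split off so that `subsetsOfSize (inside ∷ q) k` unfolds without a case distinction on `k`; in
-- `∈-subsetsOfSize` the size is `∣ p ∣`, which is not in constructor form.
subsetsWithHead : Subset n → ℕ → List (Subset (suc n))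

subsetsOfSize []            zero    = [ [] ]
subsetsOfSize []            (suc k) = []
subsetsOfSize (outside ∷ q) k       = map (outside ∷_) (subsetsOfSize q k)
subsetsOfSize (inside  ∷ q) k       =
  subsetsWithHead q k ++ map (outside ∷_) (subsetsOfSize q k)

subsetsWithHead q zero    = []
subsetsWithHead q (suc k) = map (inside ∷_) (subsetsOfSize q k)

length-subsetsOfSize : (q : Subset n) (k : ℕ) → length (subsetsOfSize q k) ≡ ∣ q ∣ C k
length-subsetsOfSize []            zero    = refl
length-subsetsOfSize []            (suc k) = sym (k>n⇒nCk≡0 {0} {suc k} (s≤s z≤n))
length-subsetsOfSize (outside ∷ q) k       =
  trans (length-map _ (subsetsOfSize q k)) (length-subsetsOfSize q k)
length-subsetsOfSize (inside  ∷ q) zero    =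
  trans (length-map _ (subsetsOfSize q zero)) (length-subsetsOfSize q zero)
length-subsetsOfSize (inside  ∷ q) (suc k) = begin
  length (map (inside ∷_) (subsetsOfSize q k) ++ map (outside ∷_) (subsetsOfSize q (suc k)))
    ≡⟨ length-++ (map (inside ∷_) (subsetsOfSize q k)) ⟩
  length (map (inside ∷_) (subsetsOfSize q k)) + length (map (outside ∷_) (subsetsOfSize q (suc k)))
    ≡⟨ cong₂ _+_ (trans (length-map _ (subsetsOfSize q k)) (length-subsetsOfSize q k))
                 (trans (length-map _ (subsetsOfSize q (suc k))) (length-subsetsOfSize q (suc k))) ⟩
  ∣ q ∣ C k + ∣ q ∣ C suc k
    ≡⟨ nCk+nC[k+1]≡[n+1]C[k+1] ∣ q ∣ k ⟩
  suc ∣ q ∣ C suc k ∎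
  where open ≡-Reasoning

∈-subsetsOfSize : (p q : Subset n) → p ⊆ q → p ∈ subsetsOfSize q ∣ p ∣
∈-subsetsOfSize []            []            p⊆q = here refl
∈-subsetsOfSize (inside  ∷ p) (outside ∷ q) p⊆q with () ← p⊆q here
∈-subsetsOfSize (inside  ∷ p) (inside  ∷ q) p⊆q =
  ∈-++⁺ˡ (∈-map⁺ (inside ∷_) (∈-subsetsOfSize p q (drop-∷-⊆ p⊆q)))
∈-subsetsOfSize (outside ∷ p) (inside  ∷ q) p⊆q =
  ∈-++⁺ʳ (subsetsWithHead q ∣ p ∣) (∈-map⁺ (outside ∷_) (∈-subsetsOfSize p q (drop-∷-⊆ p⊆q)))
∈-subsetsOfSize (outside ∷ p) (outside ∷ q) p⊆q =
  ∈-map⁺ (outside ∷_) (∈-subsetsOfSize p q (drop-∷-⊆ p⊆q))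

-- Images of subsets under vertex maps

∈-image⁺ : (φ : Fin k → Fin n) {p : Subset k} {x : Fin k} → x ∈ˢ p → φ x ∈ˢ image φ p
∈-image⁺ φ {inside  ∷ p} here       = x∈p∪q⁺ (inj₁ (x∈⁅x⁆ (φ zero)))
∈-image⁺ φ {inside  ∷ p} (there x∈) = x∈p∪q⁺ (inj₂ (∈-image⁺ (φ ∘ suc) x∈))
∈-image⁺ φ {outside ∷ p} (there x∈) = ∈-image⁺ (φ ∘ suc) x∈

∈-image⁻ : (φ : Fin k → Fin n) (p : Subset k) {y : Fin n} →
           y ∈ˢ image φ p → ∃ λ x → x ∈ˢ p × y ≡ φ x
∈-image⁻ φ []            y∈ = contradiction y∈ ∉⊥
∈-image⁻ φ (outside ∷ p) y∈ with ∈-image⁻ (φ ∘ suc) p y∈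
... | x , x∈ , eq = suc x , there x∈ , eq
∈-image⁻ φ (inside ∷ p) y∈ with x∈p∪q⁻ ⁅ φ zero ⁆ (image (φ ∘ suc) p) y∈
... | inj₁ y∈₀ = zero , here , x∈⁅y⁆⇒x≡y _ y∈₀
... | inj₂ y∈₁ with ∈-image⁻ (φ ∘ suc) p y∈₁
...   | x , x∈ , eq = suc x , there x∈ , eq

-- Ensures that distinct edges of a graph remain distinct pairs after its vertices are placed in the
-- hypergraph.
image-injective : (φ : Fin k → Fin n) → Injective _≡_ _≡_ φ → Injective _≡_ _≡_ (image φ)
image-injective φ inj {p} {q} eq = ⊆-antisym (half eq) (half (sym eq))
  where
  half : ∀ {p q} → image φ p ≡ image φ q → p ⊆ q
  half {p} {q} eq x∈ with ∈-image⁻ φ q (subst (φ _ ∈ˢ_) eq (∈-image⁺ φ x∈))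
  ... | y , y∈ , φx≡φy = subst (_∈ˢ q) (sym (inj φx≡φy)) y∈

image-∅ : (φ : Fin k → Fin n) → image φ ∅ ≡ ∅
image-∅ {zero}  φ = refl
image-∅ {suc k} φ = image-∅ (φ ∘ suc)

image-⁅⁆ : (φ : Fin k → Fin n) (i : Fin k) → image φ ⁅ i ⁆ ≡ ⁅ φ i ⁆
image-⁅⁆ φ zero    = trans (cong (⁅ φ zero ⁆ ∪_) (image-∅ (φ ∘ suc))) (∪-identityʳ _)
image-⁅⁆ φ (suc i) = image-⁅⁆ (φ ∘ suc) i

-- Separates the two ends of an edge `joining i j`, which is a concatenation of singletons.
image-++ : (φ : Fin (s + t) → Fin n) (p : Subset s) (q : Subset t) →
           image φ (p ++ᵛ q) ≡ image (φ ∘ (_↑ˡ t)) p ∪ image (φ ∘ (s ↑ʳ_)) q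
image-++ φ []            q = sym (∪-identityˡ _)
image-++ φ (outside ∷ p) q = image-++ (φ ∘ suc) p q
image-++ φ (inside  ∷ p) q =
  trans (cong (⁅ φ zero ⁆ ∪_) (image-++ (φ ∘ suc) p q)) (sym (∪-assoc _ _ _))

-- Cliques and common neighbourhoods

Clique : List (Subset n) → Subset n → Set
Clique G e = ∀ {x y} → x ∈ˢ e → y ∈ˢ e → x ≢ y → ⁅ x ⁆ ∪ ⁅ y ⁆ ∈ G

module _ {n : ℕ} (G : List (Subset n)) where

  open DecMembership (_≟ˢ_ {n}) using () renaming (_∈?_ to _∈ᴳ?_)

  Missing : Subset n → Set
  Missing e = ∃ λ x → ∃ λ y → x ∈ˢ e × y ∈ˢ e × x ≢ y × ⁅ x ⁆ ∪ ⁅ y ⁆ ∉ G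

  missing? : Decidable Missing
  missing? e = any? λ x → any? λ y →
    x ∈? e ×-dec y ∈? e ×-dec ¬? (x Fin.≟ y) ×-dec ¬? (⁅ x ⁆ ∪ ⁅ y ⁆ ∈ᴳ? G)

  ¬missing⇒clique : {e : Subset n} → ¬ Missing e → Clique G e
  ¬missing⇒clique ¬m {x} {y} x∈ y∈ x≢y = decidable-stable (⁅ x ⁆ ∪ ⁅ y ⁆ ∈ᴳ? G)
    λ ∉G → ¬m (x , y , x∈ , y∈ , x≢y , ∉G)

  -- Taken over a set `p` because an edge is stored as a subset, without named ends.
  CommonNeighbour : Subset n → Fin n → Set
  CommonNeighbour p z = z ∉ˢ p × (∀ x → x ∈ˢ p → ⁅ x ⁆ ∪ ⁅ z ⁆ ∈ G)

  commonNeighbour? : ∀ p → Decidable (CommonNeighbour p)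
  commonNeighbour? p z =
    ¬? (z ∈? p) ×-dec all? λ x → (x ∈? p) →-dec (⁅ x ⁆ ∪ ⁅ z ⁆ ∈ᴳ? G)

  N : Subset n → Subset n
  N p = ⟦ commonNeighbour? p ⟧

  -- A list of candidates: its members need not be cliques, but it contains every clique that
  -- extends `p` by `k` vertices.
  cliquesAbove : ℕ → Subset n → List (Subset n)
  cliquesAbove k p = map (p ∪_) (subsetsOfSize (N p) k)

  clique─⊆N : {p e : Subset n} → Clique G e → p ⊆ e → e ─ p ⊆ N p
  clique─⊆N {p} {e} clique p⊆e {z} z∈ = ∈⟦⟧⁺ (commonNeighbour? p)
    ( z∉p
    , λ x x∈p → clique (p⊆e x∈p) (p─q⊆p e p z∈) (λ { refl → z∉p x∈p }))
    where z∉p = x∈p─q⇒x∉q e p z∈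

  -- Write `e` as `p ∪ (e ─ p)`; the vertices of `e ─ p` are common neighbours of `p`, and there are
  -- `k` of them.
  clique∈cliquesAbove : {p e : Subset n} → Clique G e → p ⊆ e → ∣ e ∣ ≡ ∣ p ∣ + k →
                        e ∈ cliquesAbove k p
  clique∈cliquesAbove {k} {p} {e} clique p⊆e ∣e∣≡ =
    subst₂ (λ k e → e ∈ cliquesAbove k p) ∣e─p∣≡k (p∪q─p≡q p⊆e)
      (∈-map⁺ (p ∪_) (∈-subsetsOfSize (e ─ p) (N p) (clique─⊆N clique p⊆e)))
    where
    ∣e─p∣≡k : ∣ e ─ p ∣ ≡ k
    ∣e─p∣≡k = ℕ.+-cancelˡ-≡ ∣ p ∣ _ _ (trans (∣p∣+∣q─p∣≡∣q∣ p e p⊆e) ∣e∣≡)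

  -- Every clique in `es` contains an edge of `G`, so the lists `cliquesAbove k p` for `p` in `G`
  -- cover `es`, and each has at most `b C k` entries.
  cliques-bound : All (λ p → ∣ p ∣ ≡ 2) G → {b : ℕ} → (∀ {p} → p ∈ G → ∣ N p ∣ ≤ b) →
                  {es : List (Subset n)} → Unique es → All (Clique G) es →
                  All (λ e → ∣ e ∣ ≡ 2 + k) es → length es ≤ length G * (b C k)
  cliques-bound {k} G₂ {b} N≤b {es} u cliques sizes = ℕ.≤-trans
    (unique-⊆⇒length≤ u covered)
    (length-concatMap≤ (cliquesAbove k) G λ {p} p∈ → ℕ.≤-trans
      (ℕ.≤-reflexive (trans (length-map (p ∪_) (subsetsOfSize (N p) k))
                            (length-subsetsOfSize (N p) k)))
      (C-monoˡ-≤ k (N≤b p∈)))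
    where
    covered : ∀ {e} → e ∈ es → e ∈ concatMap (cliquesAbove k) G
    -- Any two distinct vertices of `e` will do: as `e` is a clique, the pair they form is an edge
    -- of `G`.
    covered {e} e∈ with enumerate {t = 2} e
      (ℕ.≤-trans (ℕ.m≤m+n 2 k) (ℕ.≤-reflexive (sym (All.lookup sizes e∈))))
    ... | f , inj , f∈ = ∈-concatMap⁺ (cliquesAbove k) (Any.map
        (λ { refl → clique∈cliquesAbove clique (⁅x⁆∪⁅y⁆⊆ (f∈ zero) (f∈ (suc zero)))
                      (trans (All.lookup sizes e∈) (cong (_+ k) (sym (All.lookup G₂ p∈)))) })
        p∈)
      where
      clique = All.lookup cliques e∈
      p∈ = clique (f∈ zero) (f∈ (suc zero)) λ eq → contradiction (inj eq) λ ()

-- One part is taken from `p` and the other from `N (edges G) p`; they are disjoint because common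
-- neighbours lie outside `p` by definition.
commonNeighbours⇒K : (G : Hypergraph n) {p : Subset n} → s ≤ ∣ p ∣ → t ≤ ∣ N (edges G) p ∣ →
                     ContainsGraph (K s t) G
commonNeighbours⇒K {n} {s} {t} G {p} s≤ t≤ = φ , φ-inj , All.tabulate covered
  where
  f∃ = enumerate p s≤
  g∃ = enumerate (N (edges G) p) t≤
  f = proj₁ f∃
  g = proj₁ g∃

  neighbour : ∀ j → CommonNeighbour (edges G) p (g j)
  neighbour j = ∈⟦⟧⁻ (commonNeighbour? (edges G) p) (proj₂ (proj₂ g∃) j)

  f≢g : ∀ i j → f i ≢ g j
  f≢g i j eq = proj₁ (neighbour j) (subst (_∈ˢ p) eq (proj₂ (proj₂ f∃) i))

  φ : Fin (s + t) → Fin n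
  φ i = [ f , g ]′ (splitAt s i)

  φ-inj : Injective _≡_ _≡_ φ
  φ-inj {i} {j} eq with splitAt s i in eqᵢ | splitAt s j in eqⱼ
  ... | inj₁ a | inj₁ b = trans (sym (Fin.splitAt⁻¹-↑ˡ eqᵢ))
    (trans (cong (_↑ˡ t) (proj₁ (proj₂ f∃) eq)) (Fin.splitAt⁻¹-↑ˡ eqⱼ))
  ... | inj₁ a | inj₂ b = contradiction eq (f≢g a b)
  ... | inj₂ a | inj₁ b = contradiction (sym eq) (f≢g b a)
  ... | inj₂ a | inj₂ b = trans (sym (Fin.splitAt⁻¹-↑ʳ {s} eqᵢ))
    (trans (cong (s ↑ʳ_) (proj₁ (proj₂ g∃) eq)) (Fin.splitAt⁻¹-↑ʳ {s} eqⱼ))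

  image-joining : ∀ i j → image φ (joining i j) ≡ ⁅ f i ⁆ ∪ ⁅ g j ⁆
  image-joining i j = trans (image-++ φ ⁅ i ⁆ ⁅ j ⁆) (cong₂ _∪_
    (trans (image-⁅⁆ (φ ∘ (_↑ˡ t)) i) (cong (⁅_⁆ ∘ [ f , g ]′) (splitAt-↑ˡ s i t)))
    (trans (image-⁅⁆ (φ ∘ (s ↑ʳ_)) j) (cong (⁅_⁆ ∘ [ f , g ]′) (splitAt-↑ʳ s t j))))

  covered : ∀ {e} → e ∈ edges (hypergraph (K s t)) → image φ e ∈ edges G
  covered e∈ with ∈-cartesianProductWith⁻ joining (allFin s) (allFin t) e∈
  ... | i , j , _ , _ , refl = subst (_∈ edges G) (sym (image-joining i j))
    (proj₂ (neighbour j) (f i) (proj₂ (proj₂ f∃) i))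

-- The greedy choice of pairs

-- An entry of `chosen` is a pair together with the hyperedge it was chosen in. Sublists of `es`,
-- rather than mere subsets, let `chosen` and `remaining` inherit distinctness, so that hyperedges
-- can be counted and none is used twice.
record Greedy (es : List (Subset n)) : Set where
  field
    chosen       : List (Subset n × Subset n)
    remaining    : List (Subset n)
    chosen⊑      : map proj₂ chosen ⊑ es
    remaining⊑   : remaining ⊑ es
    length-split : length es ≡ length chosen + length remaining
  pairs : List (Subset n)
  pairs = map proj₁ chosen
  field
    pairs-unique : Unique pairs
    pairs-valid  : All (λ (p , e) → ∣ p ∣ ≡ 2 × p ⊆ e) chosen
    cliques      : All (Clique pairs) remaining

-- The tail is handled first, so `e` is tested against the pairs chosen from `es`: it contributes a
-- pair not yet present, or is set aside as a clique.
greedy : (es : List (Subset n)) → Greedy es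
greedy [] = record
  { chosen = [] ; remaining = [] ; chosen⊑ = [] ; remaining⊑ = [] ; length-split = refl
  ; pairs-unique = [] ; pairs-valid = [] ; cliques = [] }
greedy (e ∷ es) with greedy es
... | γ with missing? (Greedy.pairs γ) e
...   | yes (x , y , x∈ , y∈ , x≢y , ∉pairs) = record
  { chosen       = (⁅ x ⁆ ∪ ⁅ y ⁆ , e) ∷ chosen
  ; remaining    = remaining
  ; chosen⊑      = refl ∷ chosen⊑
  ; remaining⊑   = e ∷ʳ remaining⊑
  ; length-split = cong suc length-split
  ; pairs-unique = Allₚ.¬Any⇒All¬ pairs ∉pairs ∷ pairs-unique
  ; pairs-valid  = (∣⁅x⁆∪⁅y⁆∣≡2 x≢y , ⁅x⁆∪⁅y⁆⊆ x∈ y∈) ∷ pairs-valid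
  -- Hyperedges set aside earlier remain cliques, since the graph only gains edges.
  ; cliques      = All.map (λ c {_} {_} x∈ y∈ x≢y → there (c x∈ y∈ x≢y)) cliques
  }
  where open Greedy γ
...   | no ¬missing = record
  { chosen       = chosen
  ; remaining    = e ∷ remaining
  ; chosen⊑      = e ∷ʳ chosen⊑
  ; remaining⊑   = refl ∷ remaining⊑
  ; length-split = trans (cong suc length-split) (sym (ℕ.+-suc (length chosen) _))
  ; pairs-unique = pairs-unique
  ; pairs-valid  = pairs-valid
  ; cliques      = (λ {_} {_} → ¬missing⇒clique pairs ¬missing) ∷ cliques
  }
  where open Greedy γ

-- The graph of chosen pairs and the bound for Berge-free hypergraphs

module _ (H : Hypergraph n) (γ : Greedy (edges H)) where
  open Greedy γ

  pairGraph : Hypergraph n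
  pairGraph = mkHypergraph pairs pairs-unique

  pairGraph-uniform : Uniform 2 pairGraph
  pairGraph-uniform = Allₚ.map⁺ (All.map proj₁ pairs-valid)

  -- Each edge of a copy of `F` is a chosen pair; map it to the hyperedge in which it was chosen.
  -- This is injective because no hyperedge has more than one pair chosen in it.
  pairGraph-injects : (F : Graph k) → ContainsGraph F pairGraph → InjectsBerge F H
  pairGraph-injects F (φ , φ-inj , φF∈) = φ , φ-inj , g , g-inj , φe⊆
    where
    E = Fin (size (hypergraph F))

    choice : (i : E) → ∃ λ c → c ∈ chosen × image φ (edge (hypergraph F) i) ≡ proj₁ c
    choice i = ∈-map⁻ proj₁ (All.lookup φF∈ (∈-lookup i))

    in-H : ∀ i → proj₂ (proj₁ (choice i)) ∈ edges H
    in-H i = Sublist.lookup chosen⊑ (∈-map⁺ proj₂ (proj₁ (proj₂ (choice i))))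

    g : E → Fin (size H)
    g i = index (in-H i)

    edge-g : ∀ i → proj₂ (proj₁ (choice i)) ≡ edge H (g i)
    edge-g i = lookup-index (in-H i)

    g-inj : Injective _≡_ _≡_ g
    g-inj {i} {j} eq = edge-injective (hypergraph F) (image-injective φ φ-inj
      (trans (proj₂ (proj₂ (choice i))) (trans (cong proj₁ same) (sym (proj₂ (proj₂ (choice j)))))))
      where
      -- Equal positions in `H` give equal hyperedges, and a hyperedge occurs only once in `chosen`.
      same : proj₁ (choice i) ≡ proj₁ (choice j)
      same = unique-map⇒injective proj₂ (⊑-unique chosen⊑ (distinct H))
        (proj₁ (proj₂ (choice i))) (proj₁ (proj₂ (choice j)))
        (trans (edge-g i) (trans (cong (edge H) eq) (sym (edge-g j))))

    φe⊆ : ∀ i → image φ (edge (hypergraph F) i) ⊆ edge H (g i)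
    φe⊆ i = subst₂ _⊆_ (sym (proj₂ (proj₂ (choice i)))) (edge-g i)
      (proj₂ (All.lookup pairs-valid (proj₁ (proj₂ (choice i)))))

-- Here `k` is `r - 2` and `suc t` is the `t` of the theorem, so `t` bounds the common
-- neighbourhoods. The hyperedges with a chosen pair number exactly `size G`, which gives the
-- summand 1.
bergeFree-size : (H : Hypergraph n) → BergeFree (2 + k) (K 2 (suc t)) H →
                 size H ≤ (1 + t C k) * ex n (K 2 (suc t))
bergeFree-size {n} {k} {t} H (uniform , free) = begin
  size H                                   ≡⟨ length-split ⟩
  length chosen + length remaining         ≡⟨ cong (_+ length remaining) (length-map proj₁ chosen) ⟨
  size G + length remaining                ≤⟨ ℕ.+-monoʳ-≤ (size G) remaining≤ ⟩
  size G + size G * (t C k)                ≡⟨ cong (λ x → size G + x) (ℕ.*-comm (size G) (t C k)) ⟩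
  (1 + t C k) * size G                     ≤⟨ ℕ.*-monoʳ-≤ (1 + t C k) (ex-upper F G G-free) ⟩
  (1 + t C k) * ex n F                     ∎
  where
  open ℕ.≤-Reasoning
  F = K 2 (suc t)
  γ = greedy (edges H)
  open Greedy γ
  G = pairGraph H γ

  G-free : GraphFree F G
  G-free = pairGraph-uniform H γ , free ∘ injects⇒contains F H ∘ pairGraph-injects H γ F

  N≤t : ∀ {p} → p ∈ edges G → ∣ N (edges G) p ∣ ≤ t
  -- With `suc t` common neighbours, the two ends of `p` would span a `K 2 (suc t)` in `G`.
  N≤t {p} p∈ = s≤s⁻¹ (ℕ.≰⇒> λ t<N → proj₂ G-free (commonNeighbours⇒K G {p}
    (ℕ.≤-reflexive (sym (All.lookup (proj₁ G-free) p∈))) t<N))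

  remaining≤ : length remaining ≤ size G * (t C k)
  remaining≤ = cliques-bound (edges G) (proj₁ G-free) N≤t
    (⊑-unique remaining⊑ (distinct H)) cliques (All-resp-⊆ remaining⊑ uniform)

-- Apply the bound to a hypergraph attaining the maximum, which exists because `F` has an edge.
exBerge-least : (F : Graph k) → 0 < size (hypergraph F) → {b : ℕ} →
                ((H : Hypergraph n) → BergeFree r F H → size H ≤ b) → exBerge r n F ≤ b
exBerge-least {n = n} {r} F 0<F {b} bound =
  let H , size≡ , free = exBerge-attained r n F 0<F
  in subst (_≤ b) size≡ (bound H free)

-- Natural numbers as rationals

-- The denominator is 1, as `mkℚᵘ` stores it minus one. Unnormalised fractions reduce identities in
-- `ℚ` to cross-multiplication, with no common divisors to cancel.
natᵘ : ℕ → ℚᵘ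
natᵘ m = mkℚᵘ (+ m) 0

toℚᵘ-fromℕ : ∀ m → toℚᵘ (fromℕ m) ℚᵘ.≃ natᵘ m
toℚᵘ-fromℕ m = ℚ.toℚᵘ-fromℚᵘ (natᵘ m)

fromℕ-mono-≤ : m ≤ n → fromℕ m ≤ℚ fromℕ n
fromℕ-mono-≤ {m} {n} m≤n = ℚ.toℚᵘ-cancel-≤
  (ℚᵘ.≤-respˡ-≃ (ℚᵘ.≃-sym (toℚᵘ-fromℕ m)) (ℚᵘ.≤-respʳ-≃ (ℚᵘ.≃-sym (toℚᵘ-fromℕ n))
    (*≤* (ℤ.*-monoʳ-≤-nonNeg (+ 1) (ℤ.+≤+ m≤n)))))

fromℕ-homo-+ : ∀ m n → fromℕ (m + n) ≡ fromℕ m +ℚ fromℕ n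
fromℕ-homo-+ m n = ℚ.toℚᵘ-injective (begin
  toℚᵘ (fromℕ (m + n))                  ≈⟨ toℚᵘ-fromℕ (m + n) ⟩
  natᵘ (m + n)                          ≈⟨ *≡* (cong (ℤ._* + 1) (cong₂ ℤ._+_ (ℤ.*-identityʳ (+ m)) (ℤ.*-identityʳ (+ n)))) ⟨
  natᵘ m ℚᵘ.+ natᵘ n                    ≈⟨ ℚᵘ.+-cong (toℚᵘ-fromℕ m) (toℚᵘ-fromℕ n) ⟨
  toℚᵘ (fromℕ m) ℚᵘ.+ toℚᵘ (fromℕ n)    ≈⟨ ℚ.toℚᵘ-homo-+ (fromℕ m) (fromℕ n) ⟨
  toℚᵘ (fromℕ m +ℚ fromℕ n)             ∎)
  where open ℚᵘ.≃-Reasoning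

-- Cross-multiplication turns the claim into the identity of naturals `a * c ≡ d * b`. The
-- absorption identity has this shape, and `d = 1` gives multiplicativity of `fromℕ`.
/-*-fromℕ : ∀ a b c d .{{_ : NonZero d}} → a * c ≡ d * b →
            (+ a / d) *ℚ fromℕ c ≡ fromℕ b
/-*-fromℕ a b c (suc d) ac≡db = ℚ.toℚᵘ-injective (begin
  toℚᵘ ((+ a / suc d) *ℚ fromℕ c)             ≈⟨ ℚ.toℚᵘ-homo-* (+ a / suc d) (fromℕ c) ⟩
  toℚᵘ (+ a / suc d) ℚᵘ.* toℚᵘ (fromℕ c)      ≈⟨ ℚᵘ.*-cong (ℚ.toℚᵘ-fromℚᵘ (mkℚᵘ (+ a) d)) (toℚᵘ-fromℕ c) ⟩
  mkℚᵘ (+ a) d ℚᵘ.* natᵘ c                    ≈⟨ *≡* eq ⟩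
  natᵘ b                                      ≈⟨ toℚᵘ-fromℕ b ⟨
  toℚᵘ (fromℕ b)                              ∎)
  where
  open ℚᵘ.≃-Reasoning
  eq : + a ℤ.* + c ℤ.* + 1 ≡ + b ℤ.* + (suc d * 1)
  eq = trans (ℤ.*-identityʳ _) (trans (sym (ℤ.pos-* a c)) (trans (cong +_ (trans ac≡db
    (trans (ℕ.*-comm (suc d) b) (cong (b *_) (sym (ℕ.*-identityʳ (suc d))))))) (ℤ.pos-* b _)))

fromℕ-homo-* : ∀ m n → fromℕ (m * n) ≡ fromℕ m *ℚ fromℕ n
fromℕ-homo-* m n = sym (/-*-fromℕ m (m * n) n 1 (sym (ℕ.*-identityˡ (m * n))))

-- By absorption the coefficient equals `t C k + 2 * suc t + 1`, which exceeds the factor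
-- `1 + t C k` of the hypothesis by `2 * suc t`. It is thus the image of a natural number, and the
-- comparison takes place in `ℕ`.
≤-coefficient : ∀ k t {a b} → a ≤ (1 + t C k) * b →
  fromℕ a ≤ℚ
  ((+ suc k / suc t) *ℚ fromℕ (suc t C suc k) +ℚ fromℕ 2 *ℚ fromℕ (suc t) +ℚ fromℕ 1) *ℚ fromℕ b
≤-coefficient k t {a} {b} a≤ = begin
  fromℕ a
    ≤⟨ fromℕ-mono-≤ (ℕ.≤-trans a≤ (ℕ.*-monoˡ-≤ b 1+c≤)) ⟩
  fromℕ ((c + 2 * suc t + 1) * b)
    ≡⟨ fromℕ-homo-* (c + 2 * suc t + 1) b ⟩
  fromℕ (c + 2 * suc t + 1) *ℚ fromℕ b
    ≡⟨ cong (_*ℚ fromℕ b) coefficient ⟩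
  ((+ suc k / suc t) *ℚ fromℕ (suc t C suc k) +ℚ fromℕ 2 *ℚ fromℕ (suc t) +ℚ fromℕ 1) *ℚ fromℕ b ∎
  where
  open ℚ.≤-Reasoning
  c = t C k

  1+c≤ : 1 + c ≤ c + 2 * suc t + 1
  1+c≤ = ℕ.≤-trans (ℕ.≤-reflexive (ℕ.+-comm 1 c)) (ℕ.+-monoˡ-≤ 1 (ℕ.m≤m+n c _))

  coefficient : fromℕ (c + 2 * suc t + 1) ≡
    (+ suc k / suc t) *ℚ fromℕ (suc t C suc k) +ℚ fromℕ 2 *ℚ fromℕ (suc t) +ℚ fromℕ 1
  coefficient = trans (fromℕ-homo-+ (c + 2 * suc t) 1) (cong (_+ℚ fromℕ 1)
    (trans (fromℕ-homo-+ c (2 * suc t)) (cong₂ _+ℚ_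
      (sym (/-*-fromℕ (suc k) c (suc t C suc k) (suc t) ([1+k]*[1+n]C[1+k]≡[1+n]*nCk t k))) (fromℕ-homo-* 2 (suc t)))))

theorem1p5 : ∀ (r t : ℕ) .{{_ : NonZero t}} → 3 ≤ r → r ∸ 1 ≤ t → ∀ (n : ℕ) →
    fromℕ (exBerge r n (K 2 t)) ≤ℚ
    ((+ (r ∸ 1) / t) *ℚ fromℕ (t C (r ∸ 1)) +ℚ fromℕ 2 *ℚ fromℕ t +ℚ fromℕ 1) *ℚ fromℕ (ex n (K 2 t))
-- Matching `r` as `suc (suc k)` makes `r ∸ 1` compute to `suc k`; the final `s≤s z≤n` says that
-- `K 2 (suc t)` has an edge.
theorem1p5 (suc (suc k)) (suc t) (s≤s (s≤s _)) _ n =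
  ≤-coefficient k t {exBerge (2 + k) n (K 2 (suc t))} {ex n (K 2 (suc t))}
    (exBerge-least {n = n} {r = 2 + k} (K 2 (suc t)) (s≤s z≤n) (bergeFree-size {n} {k} {t}))
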